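{- For any recurrent set $F\subset A^*$ and any integer $d\ge1$, there are only finitely many finite $F$-maximal bifix codes $X\subset F$ of $F$-degree $d$.
   Context: $A$ is a finite alphabet. $F$ is recurrent if it is nonempty, closed under factors, and for all $u,w\in F$ there is $v\in F$ with $uvw\in F$. A bifix code is a set of nonempty words none of which is a proper prefix or proper suffix of another; $X\subset F$ is $F$-maximal bifix if not properly contained in a bifix code contained in $F$. A parse of $w$ with respect to $X$ is a triple $(v,x,u)$ with $w=vxu$, $v$ having no suffix in $X$, $x\in X^*$, $u$ having no prefix in $X$; $\delta_X(w)$ is their number and the $F$-degree is $d_F(X)=\max_{w\in F}\delta_X(w)$. -}

module Defs where

open import Data.List using (List; []; _++_; concat; length)
open import Data.List.Membership.Propositional using () renaming (_∈_ to _∈ˡ_)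
open import Data.List.Relation.Binary.Infix.Heterogeneous using (Infix)
open import Data.List.Relation.Binary.Prefix.Heterogeneous using (Prefix)
open import Data.List.Relation.Binary.Suffix.Heterogeneous using (Suffix)
open import Data.List.Relation.Unary.All using (All)
open import Data.List.Relation.Unary.Any using (Any)
open import Data.List.Relation.Unary.Unique.Propositional using (Unique)
open import Data.Nat using (ℕ; _≤_)
open import Data.Product using (∃; ∃-syntax; _×_; _,_)
open import Function.Bundles using (_⇔_)
open import Level using (0ℓ)
open import Relation.Binary.PropositionalEquality using (_≡_; _≢_)
open import Relation.Nullary using (¬_)
open import Relation.Unary using (Pred; _∈_; _⊆_; _⊂_; _≐_; Satisfiable)

Word : Set → Set
Word A = List A

Language : Set → Set₁
Language A = Pred (Word A) 0ℓ

module _ {A : Set} where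

  IsFinite : Language A → Set
  IsFinite X = ∃[ ws ] (∀ w → w ∈ X → w ∈ˡ ws)

  -- Sets of words are counted up to extensional equality _≐_.
  FinitelyMany : (Language A → Set₁) → Set₁
  FinitelyMany P = ∃[ Xs ] (∀ X → P X → Any (X ≐_) Xs)

  record Recurrent (F : Language A) : Set where
    field
      nonempty     : Satisfiable F
      factorClosed : ∀ {u w} → Infix _≡_ u w → w ∈ F → u ∈ F
      recurrent    : ∀ {u w} → u ∈ F → w ∈ F → ∃[ v ] (v ∈ F × (u ++ v ++ w) ∈ F)

  ProperPrefix : Word A → Word A → Set
  ProperPrefix u w = Prefix _≡_ u w × u ≢ w

  ProperSuffix : Word A → Word A → Set
  ProperSuffix u w = Suffix _≡_ u w × u ≢ w

  record Bifix (X : Language A) : Set where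
    field
      nonemptyWords  : ∀ {x} → x ∈ X → x ≢ []
      noProperPrefix : ∀ {x y} → x ∈ X → y ∈ X → ¬ ProperPrefix x y
      noProperSuffix : ∀ {x y} → x ∈ X → y ∈ X → ¬ ProperSuffix x y

  record MaximalBifix (F X : Language A) : Set₁ where
    field
      bifix    : Bifix X
      included : X ⊆ F
      maximal  : ¬ (∃[ Y ] (Bifix Y × Y ⊆ F × X ⊂ Y))

  Star : Language A → Language A
  Star X w = ∃[ xs ] (All X xs × concat xs ≡ w)

  IsParse : Language A → Word A → Pred (Word A × Word A × Word A) 0ℓ
  IsParse X w (v , x , u) =
    w ≡ v ++ x ++ u ×
    ¬ (∃[ s ] (s ∈ X × Suffix _≡_ s v)) ×
    x ∈ Star X ×
    ¬ (∃[ p ] (p ∈ X × Prefix _≡_ p u))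

  HasCardinality : {B : Set} → Pred B 0ℓ → ℕ → Set
  HasCardinality P n =
    ∃[ bs ] (Unique bs × length bs ≡ n × (∀ b → b ∈ˡ bs ⇔ b ∈ P))

  -- The graph of δ_X: for an arbitrary predicate X the number of parses
  -- is not computable, so "δ_X(w) = n" is a relation.
  ParseCount : Language A → Word A → ℕ → Set
  ParseCount X w n = HasCardinality (IsParse X w) n

  -- d_F(X) = d: the maximum of δ_X over F exists and equals d.
  record HasDegree (F X : Language A) (d : ℕ) : Set where
    field
      attained   : ∃[ w ] (w ∈ F × ParseCount X w d)
      upperBound : ∀ {w n} → w ∈ F → ParseCount X w n → n ≤ d

{-# OPTIONS --safe #-}
-- For a bifix code X the number L(w) of parses of w equals the number of suffixes of w
-- having no prefix in X, because each such suffix u extends to exactly one parse (v , x , u).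
-- This number is monotone with respect to factors.  If X is finite of degree d, then
-- L(w) = d for all sufficiently long w in F, and a threshold N for this can be chosen
-- depending only on d and F; then no word of X is longer than N + 1.
--
-- The threshold is found by induction on d.  Let N work for d.  A word of F longer than N
-- satisfies L ≤ d exactly when all its factors of length N + 1 do: if L(cz) ≤ d ≤ L(z) with
-- |z| = N, then cz has a prefix in X, and prepending c does not change the number of parses
-- of any word of F starting with z.  So the lengths of the words with L ≤ d are governed by
-- a subset T of the finite set of words of length N + 1, and it suffices to take the maximum,
-- over those T for which words of F with all (N + 1)-factors in T have bounded length, of
-- such a bound.
module Submission where

open import Defs
open import Axiom.ExcludedMiddle using (ExcludedMiddle)
open import Data.Fin using (Fin)
open import Data.List using (List; []; _∷_; _++_; _∷ʳ_; map; filter; concat; length; take; drop; allFin; cartesianProductWith)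
open import Data.List.Membership.Propositional using (lose) renaming (_∈_ to _∈ˡ_)
open import Data.List.Membership.Propositional.Properties using (∈-map⁺; ∈-map⁻; ∈-++⁺ˡ; ∈-++⁺ʳ; ∈-filter⁺; ∈-filter⁻; ∈-allFin; ∈-cartesianProductWith⁺)
open import Data.List.Membership.Propositional.Properties.WithK using (unique∧set⇒bag)
open import Data.List.Properties using (++-assoc; ++-identityʳ; ++-cancelˡ; ∷-injectiveʳ; length-++; length-map; length-take; take++drop≡id)
open import Data.List.Relation.Binary.BagAndSetEquality using (∼bag⇒↭)
open import Data.List.Relation.Binary.Infix.Heterogeneous using (Infix; here; there; _++ⁱ_)
open import Data.List.Relation.Binary.Permutation.Propositional.Properties using (↭-length)
open import Data.List.Relation.Binary.Pointwise as Pointwise using (Pointwise-≡⇒≡; [])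
open import Data.List.Relation.Binary.Prefix.Heterogeneous using (Prefix; []; _∷_; _++ᵖ_)
import Data.List.Relation.Binary.Prefix.Heterogeneous.Properties as Prefixₚ
open import Data.List.Relation.Binary.Suffix.Heterogeneous using (Suffix; here; there)
import Data.List.Relation.Binary.Suffix.Heterogeneous.Properties as Suffixₚ
open import Data.List.Relation.Unary.All as All using ([]; _∷_)
import Data.List.Relation.Unary.AllPairs as AllPairs
open import Data.List.Relation.Unary.Any using (here; there)
open import Data.List.Relation.Unary.Unique.Propositional using (Unique)
open import Data.List.Relation.Unary.Unique.Propositional.Properties using () renaming (map⁺ to Unique-map⁺)
open import Data.Nat using (ℕ; zero; suc; _+_; _≤_; _<_; _≤?_; _⊔_; z≤n; s≤s; s≤s⁻¹)
open import Data.Nat.Properties using (≤-refl; ≤-reflexive; ≤-trans; <⇒≤; <⇒≱; ≮⇒≥; ≰⇒>; 1+n≰n; +-suc; m≤n+m; m≤m⊔n; m≤n⊔m; m≤n⇒m≤1+n; m≤n⇒m⊓n≡m; m≤n⇒m<n∨m≡n; module ≤-Reasoning)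
open import Data.Product using (∃; ∃-syntax; _×_; _,_; proj₁; proj₂)
open import Data.Sum as Sum using (_⊎_; inj₁; inj₂; [_,_]′)
open import Function using (_∘_)
open import Function.Bundles using (_↔_; _⇔_; mk⇔; Equivalence; Inverse)
open import Level using (0ℓ)
open import Relation.Binary.PropositionalEquality using (_≡_; _≢_; refl; sym; trans; cong; subst)
open import Relation.Nullary using (¬_; yes; no; contradiction)
open import Relation.Nullary.Decidable using (decidable-stable)
open import Relation.Unary using (Pred; _∈_; Decidable)

-- Finite sets

Unique-length-≡ : {B : Set} {xs ys : List B} → Unique xs → Unique ys →
  (∀ {b} → b ∈ˡ xs ⇔ b ∈ˡ ys) → length xs ≡ length ys
Unique-length-≡ xs! ys! xs⇔ys = ↭-length (∼bag⇒↭ (unique∧set⇒bag xs! ys! xs⇔ys))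

sublists : {B : Set} → List B → List (List B)
sublists []       = [] ∷ []
sublists (x ∷ xs) = map (x ∷_) (sublists xs) ++ sublists xs

-- Lets a subset cut out by a predicate be found in a list fixed beforehand; used both for the sets
-- of words with few parses and for the codes themselves.
filter∈sublists : {B : Set} {P : Pred B 0ℓ} (P? : Decidable P) (xs : List B) →
  filter P? xs ∈ˡ sublists xs
filter∈sublists P? [] = here refl
filter∈sublists P? (x ∷ xs) with P? x
... | yes _ = ∈-++⁺ˡ (∈-map⁺ (x ∷_) (filter∈sublists P? xs))
... | no  _ = ∈-++⁺ʳ (map (x ∷_) (sublists xs)) (filter∈sublists P? xs)

-- Excluded middle decides for each `b` whether some bound exists. Entries without one are skipped,
-- and the maximum over the others works by monotonicity.
commonBound : ExcludedMiddle 0ℓ → {B : Set} (P : B → ℕ → Set) →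
  (∀ {b m n} → m ≤ n → P b m → P b n) → (bs : List B) →
  ∃[ n ] (∀ {b} → b ∈ˡ bs → ∃ (P b) → P b n)
commonBound em P mono [] = 0 , λ ()
commonBound em P mono (b ∷ bs) with commonBound em P mono bs | em {∃ (P b)}
... | n , bound | yes (m , Pbm) = m ⊔ n , λ where
  (here refl) _ → mono (m≤m⊔n m n) Pbm
  (there b∈)  p → mono (m≤n⊔m m n) (bound b∈ p)
... | n , bound | no ∄ = n , λ where
  (here refl) p → contradiction p ∄
  (there b∈)  p → bound b∈ p

module _ {A : Set} where

  wordsUpTo : List A → ℕ → List (Word A)
  wordsUpTo as zero    = [] ∷ []
  wordsUpTo as (suc n) = [] ∷ cartesianProductWith _∷_ as (wordsUpTo as n)

  ∈-wordsUpTo : ∀ {as} → (∀ a → a ∈ˡ as) → ∀ {n} w → length w ≤ n → w ∈ˡ wordsUpTo as n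
  ∈-wordsUpTo all {zero}  []      _         = here refl
  ∈-wordsUpTo all {suc n} []      _         = here refl
  ∈-wordsUpTo all {suc n} (a ∷ w) (s≤s w≤n) =
    there (∈-cartesianProductWith⁺ _∷_ (all a) (∈-wordsUpTo all w w≤n))

  -- Prefixes and factors

  prefix⇒++ : ∀ {v w : Word A} → Prefix _≡_ v w → ∃[ s ] w ≡ v ++ s
  prefix⇒++ {w = w} []         = w , refl
  prefix⇒++         (refl ∷ p) = let s , eq = prefix⇒++ p in s , cong (_ ∷_) eq

  prefix-++ : ∀ (v : Word A) s → Prefix _≡_ v (v ++ s)
  prefix-++ []      s = []
  prefix-++ (a ∷ v) s = refl ∷ prefix-++ v s

  prefix-take : ∀ n (w : Word A) → Prefix _≡_ (take n w) w
  prefix-take n w = subst (Prefix _≡_ (take n w)) (take++drop≡id n w) (prefix-++ (take n w) (drop n w))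

  prefix-∷ʳ : ∀ {p} (w : Word A) {b} → Prefix _≡_ p (w ∷ʳ b) → Prefix _≡_ p w ⊎ p ≡ w ∷ʳ b
  prefix-∷ʳ []      []          = inj₁ []
  prefix-∷ʳ []      (refl ∷ []) = inj₂ refl
  prefix-∷ʳ (c ∷ w) []          = inj₁ []
  prefix-∷ʳ (c ∷ w) (refl ∷ p)  = Sum.map (refl ∷_) (cong (c ∷_)) (prefix-∷ʳ w p)

  ++-comparable : ∀ (x y : Word A) {s t} → x ++ s ≡ y ++ t → Prefix _≡_ x y ⊎ Prefix _≡_ y x
  ++-comparable []      y       _  = inj₁ []
  ++-comparable (a ∷ x) []      _  = inj₂ []
  ++-comparable (a ∷ x) (b ∷ y) eq with refl ← cong (take 1) eq =
    Sum.map (refl ∷_) (refl ∷_) (++-comparable x y (∷-injectiveʳ eq))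

  prefix-shorten : ∀ {p} (w s : Word A) → length p ≤ length w → Prefix _≡_ p (w ++ s) → Prefix _≡_ p w
  prefix-shorten []      s z≤n       []         = []
  prefix-shorten (c ∷ w) s _         []         = []
  prefix-shorten (c ∷ w) s (s≤s p≤w) (refl ∷ p) = refl ∷ prefix-shorten w s p≤w p

  length-++-≤ʳ : ∀ (s w : Word A) → length w ≤ length (s ++ w)
  length-++-≤ʳ s w = subst (length w ≤_) (sym (length-++ s)) (m≤n+m (length w) (length s))

  ∷⋠ˢ : ∀ {c} {v : Word A} → ¬ Suffix _≡_ (c ∷ v) v
  ∷⋠ˢ = 1+n≰n ∘ Suffixₚ.length-mono

  Infix-refl : ∀ {w : Word A} → Infix _≡_ w w
  Infix-refl = here (Prefixₚ.fromPointwise (Pointwise.refl refl))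

-- Parses with respect to a bifix code

module Code (em : ExcludedMiddle 0ℓ) {A : Set} (X : Language A) where

  HasPrefix HasSuffix : Language A
  HasPrefix u = ∃[ p ] (p ∈ X × Prefix _≡_ p u)
  HasSuffix v = ∃[ s ] (s ∈ X × Suffix _≡_ s v)

  -- If `c ∷ v` is a code word it becomes the first factor of the middle part; otherwise `c` just
  -- lengthens the left part.
  extend : A → Word A × Word A × Word A → Word A × Word A × Word A
  extend c (v , x , u) with em {(c ∷ v) ∈ X}
  ... | yes _ = [] , (c ∷ v) ++ x , u
  ... | no  _ = c ∷ v , x , u

  -- For a bifix code, the only parse of `c ∷ w` that does not come from one of `w` has empty left
  -- and middle parts, and it exists exactly when `c ∷ w` has no prefix in `X`.
  parses : Word A → List (Word A × Word A × Word A)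
  parses []      = ([] , [] , []) ∷ []
  parses (c ∷ w) with em {HasPrefix (c ∷ w)}
  ... | yes _ = map (extend c) (parses w)
  ... | no  _ = ([] , [] , c ∷ w) ∷ map (extend c) (parses w)

  L : Word A → ℕ
  L w = length (parses w)

  L-hasPrefix : ∀ {c w} → HasPrefix (c ∷ w) → L (c ∷ w) ≡ L w
  L-hasPrefix {c} {w} h with em {HasPrefix (c ∷ w)}
  ... | yes _ = length-map (extend c) (parses w)
  ... | no ¬h = contradiction h ¬h

  L-noPrefix : ∀ {c w} → ¬ HasPrefix (c ∷ w) → L (c ∷ w) ≡ suc (L w)
  L-noPrefix {c} {w} ¬h with em {HasPrefix (c ∷ w)}
  ... | yes h = contradiction h ¬h
  ... | no _  = cong suc (length-map (extend c) (parses w))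

  L-∷ : ∀ c w → L w ≤ L (c ∷ w)
  L-∷ c w with em {HasPrefix (c ∷ w)}
  ... | yes _ = ≤-reflexive (sym (length-map (extend c) (parses w)))
  ... | no _  = m≤n⇒m≤1+n (≤-reflexive (sym (length-map (extend c) (parses w))))

  L-∷-≤suc : ∀ c w → L (c ∷ w) ≤ suc (L w)
  L-∷-≤suc c w with em {HasPrefix (c ∷ w)}
  ... | yes _ = m≤n⇒m≤1+n (≤-reflexive (length-map (extend c) (parses w)))
  ... | no _  = s≤s (≤-reflexive (length-map (extend c) (parses w)))

  L-++ˡ : ∀ s w → L w ≤ L (s ++ w)
  L-++ˡ []      w = ≤-refl
  L-++ˡ (c ∷ s) w = ≤-trans (L-++ˡ s w) (L-∷ c (s ++ w))

  L-∷-≤⇒hasPrefix : ∀ {c w} → L (c ∷ w) ≤ L w → HasPrefix (c ∷ w)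
  L-∷-≤⇒hasPrefix le =
    decidable-stable em λ ¬h → 1+n≰n (≤-trans (≤-reflexive (sym (L-noPrefix ¬h))) le)

  module _ (bifix : Bifix X) where
    open Bifix bifix

    prefix⇒≡ : ∀ {x y} → x ∈ X → y ∈ X → Prefix _≡_ x y → x ≡ y
    prefix⇒≡ x∈ y∈ p = decidable-stable em λ x≢y → noProperPrefix x∈ y∈ (p , x≢y)

    suffix⇒≡ : ∀ {x y} → x ∈ X → y ∈ X → Suffix _≡_ x y → x ≡ y
    suffix⇒≡ x∈ y∈ s = decidable-stable em λ x≢y → noProperSuffix x∈ y∈ (s , x≢y)

    ¬HasPrefix-[] : ¬ HasPrefix []
    ¬HasPrefix-[] (_ , p∈ , []) = nonemptyWords p∈ refl

    ¬HasSuffix-[] : ¬ HasSuffix []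
    ¬HasSuffix-[] (_ , s∈ , here []) = nonemptyWords s∈ refl

    ¬HasSuffix-∷ : ∀ {c v} → ¬ (c ∷ v) ∈ X → ¬ HasSuffix v → ¬ HasSuffix (c ∷ v)
    ¬HasSuffix-∷ ∉ ¬h (s , s∈ , here eq) = ∉ (subst X (Pointwise-≡⇒≡ eq) s∈)
    ¬HasSuffix-∷ ∉ ¬h (s , s∈ , there p) = ¬h (s , s∈ , p)

    ¬HasSuffix-tail : ∀ {c v} → (c ∷ v) ∈ X → ¬ HasSuffix v
    ¬HasSuffix-tail cv∈ (s , s∈ , p) with refl ← suffix⇒≡ s∈ cv∈ (there p) = ∷⋠ˢ p

    extend-∈ : ∀ {c v x u} → (c ∷ v) ∈ X → extend c (v , x , u) ≡ ([] , (c ∷ v) ++ x , u)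
    extend-∈ {c} {v} cv∈ with em {(c ∷ v) ∈ X}
    ... | yes _  = refl
    ... | no cv∉ = contradiction cv∈ cv∉

    extend-∉ : ∀ {c v x u} → ¬ (c ∷ v) ∈ X → extend c (v , x , u) ≡ (c ∷ v , x , u)
    extend-∉ {c} {v} cv∉ with em {(c ∷ v) ∈ X}
    ... | yes cv∈ = contradiction cv∈ cv∉
    ... | no _    = refl

    -- The left part is empty in one branch of `extend` and not in the other. When both parses open
    -- a code word, the two code words begin the same word, so they coincide because `X` is a prefix
    -- code.
    extend-injective : ∀ {c t t′} → extend c t ≡ extend c t′ → t ≡ t′
    extend-injective {c} {v , x , u} {v′ , x′ , u′} eq
      with em {(c ∷ v) ∈ X} | em {(c ∷ v′) ∈ X}
    ... | no _ | no _ with refl ← eq = refl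
    ... | no _ | yes _ with () ← cong proj₁ eq
    ... | yes _ | no _ with () ← cong proj₁ eq
    ... | yes cv∈ | yes cv′∈
      with refl ← cong (proj₂ ∘ proj₂) eq
         | eq′ ← cong (proj₁ ∘ proj₂) eq
      with refl ← [ prefix⇒≡ cv∈ cv′∈ , sym ∘ prefix⇒≡ cv′∈ cv∈ ]′ (++-comparable (c ∷ v) (c ∷ v′) eq′)
      with refl ← ++-cancelˡ (c ∷ v) x x′ eq′ = refl

    extend-isParse : ∀ {c w t} → IsParse X w t → IsParse X (c ∷ w) (extend c t)
    extend-isParse {c} {w} {v , x , u} (w≡ , ¬suf , (xs , xs∈ , xs≡) , ¬pre)
      with em {(c ∷ v) ∈ X}
    ... | yes cv∈ = cong (c ∷_) (trans w≡ (sym (++-assoc v x u))) , ¬HasSuffix-[]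
                  , ((c ∷ v) ∷ xs , cv∈ ∷ xs∈ , cong (λ z → c ∷ v ++ z) xs≡) , ¬pre
    ... | no cv∉  = cong (c ∷_) w≡ , ¬HasSuffix-∷ cv∉ ¬suf , (xs , xs∈ , xs≡) , ¬pre

    -- Deletes the first letter `c`: from the left part if that is nonempty, else from the first
    -- code word of the middle part, whose remainder becomes the new left part.
    extend⁻¹ : ∀ {c w t} → IsParse X (c ∷ w) t →
      (t ≡ ([] , [] , c ∷ w) × ¬ HasPrefix (c ∷ w)) ⊎ ∃[ t′ ] (IsParse X w t′ × t ≡ extend c t′)
    extend⁻¹ {t = c ∷ v , x , u} (refl , ¬suf , x∈ , ¬pre) =
      inj₂ ((v , x , u)
           , (refl , (λ (s , s∈ , p) → ¬suf (s , s∈ , there p)) , x∈ , ¬pre)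
           , sym (extend-∉ λ cv∈ → ¬suf (c ∷ v , cv∈ , here (Pointwise.refl refl))))
    extend⁻¹ {t = [] , x , u} (refl , ¬suf , ([] , [] , refl) , ¬pre) = inj₁ (refl , ¬pre)
    extend⁻¹ {t = [] , x , u} (_ , _ , ([] ∷ _ , []∈ ∷ _ , _) , _) = contradiction refl (nonemptyWords []∈)
    extend⁻¹ {t = [] , x , u} (refl , ¬suf , ((c ∷ v) ∷ xs , cv∈ ∷ xs∈ , refl) , ¬pre) =
      inj₂ ((v , concat xs , u)
           , (++-assoc v (concat xs) u , ¬HasSuffix-tail cv∈ , (xs , xs∈ , refl) , ¬pre)
           , sym (extend-∈ cv∈))

    parses-sound : ∀ w {t} → t ∈ˡ parses w → IsParse X w t
    parses-sound [] (here refl) = refl , ¬HasSuffix-[] , ([] , [] , refl) , ¬HasPrefix-[]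
    parses-sound (c ∷ w) t∈ with em {HasPrefix (c ∷ w)}
    parses-sound (c ∷ w) t∈ | yes _ with _ , t′∈ , refl ← ∈-map⁻ (extend c) t∈ =
      extend-isParse (parses-sound w t′∈)
    parses-sound (c ∷ w) (here refl) | no ¬h = refl , ¬HasSuffix-[] , ([] , [] , refl) , ¬h
    parses-sound (c ∷ w) (there t∈)  | no _ with _ , t′∈ , refl ← ∈-map⁻ (extend c) t∈ =
      extend-isParse (parses-sound w t′∈)

    parses-complete : ∀ w {t} → IsParse X w t → t ∈ˡ parses w
    parses-complete [] {[] , [] , []} _ = here refl
    parses-complete (c ∷ w) parse with em {HasPrefix (c ∷ w)} | extend⁻¹ parse
    ... | yes h | inj₁ (_ , ¬h)            = contradiction h ¬h
    ... | yes _ | inj₂ (t′ , parse′ , refl) = ∈-map⁺ (extend c) (parses-complete w parse′)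
    ... | no _  | inj₁ (refl , _)          = here refl
    ... | no _  | inj₂ (t′ , parse′ , refl) = there (∈-map⁺ (extend c) (parses-complete w parse′))

    parses-unique : ∀ w → Unique (parses w)
    parses-unique []      = [] AllPairs.∷ AllPairs.[]
    parses-unique (c ∷ w) with em {HasPrefix (c ∷ w)}
    ... | yes _ = Unique-map⁺ extend-injective (parses-unique w)
    ... | no _  = All.tabulate new AllPairs.∷ Unique-map⁺ extend-injective (parses-unique w)
      where
      -- An extended parse has a nonempty left part or a nonempty middle part.
      new : ∀ {t} → t ∈ˡ map (extend c) (parses w) → ([] , [] , c ∷ w) ≢ t
      new t∈ eq with (v , x , u) , t′∈ , refl ← ∈-map⁻ (extend c) t∈ with em {(c ∷ v) ∈ X}
      ... | yes _ with () ← cong (proj₁ ∘ proj₂) eq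
      ... | no _  with () ← cong proj₁ eq

    parseCount : ∀ w → ParseCount X w (L w)
    parseCount w = parses w , parses-unique w , refl
                 , λ t → mk⇔ (parses-sound w) (parses-complete w)

    parseCount⇒≡L : ∀ {w n} → ParseCount X w n → n ≡ L w
    parseCount⇒≡L {w} (ts , ts! , refl , ts⇔) = Unique-length-≡ ts! (parses-unique w)
      λ {t} → mk⇔ (parses-complete w ∘ Equivalence.to (ts⇔ t))
                  (Equivalence.from (ts⇔ t) ∘ parses-sound w)

    -- The only prefix that `c ∷ w ∷ʳ b` has beyond those of `c ∷ w` is itself, which is not in `X`.
    -- So if `c` adds a parse on the left side of the inequality, it does on the right. The cases
    -- `k` = 0 and 1 serve the weak and the strict inequality.
    L-∷-mono : ∀ k c w b → ¬ (c ∷ w ∷ʳ b) ∈ X →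
      k + L w ≤ L (w ∷ʳ b) → k + L (c ∷ w) ≤ L (c ∷ w ∷ʳ b)
    L-∷-mono k c w b cwb∉ le with em {HasPrefix (c ∷ w)}
    ... | yes h = begin
      k + length (map (extend c) (parses w)) ≡⟨ cong (k +_) (length-map (extend c) (parses w)) ⟩
      k + L w           ≤⟨ le ⟩
      L (w ∷ʳ b)        ≤⟨ L-∷ c (w ∷ʳ b) ⟩
      L (c ∷ w ∷ʳ b)    ∎
      where open ≤-Reasoning
    ... | no ¬h = begin
      k + suc (length (map (extend c) (parses w))) ≡⟨ cong (λ n → k + suc n) (length-map (extend c) (parses w)) ⟩
      k + suc (L w)     ≡⟨ +-suc k (L w) ⟩
      suc (k + L w)     ≤⟨ s≤s le ⟩
      suc (L (w ∷ʳ b))  ≡⟨ L-noPrefix ¬h′ ⟨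
      L (c ∷ w ∷ʳ b)    ∎
      where
      open ≤-Reasoning
      ¬h′ : ¬ HasPrefix (c ∷ w ∷ʳ b)
      ¬h′ (p , p∈ , pre) with prefix-∷ʳ (c ∷ w) pre
      ... | inj₁ pre′ = ¬h (p , p∈ , pre′)
      ... | inj₂ refl = cwb∉ p∈

    -- Appending b increases L by one unless w ∷ʳ b has a suffix x in X, which is then unique
    -- and accounts for the one suffix that acquires a prefix in X.
    L-∷ʳ-cases : ∀ w b → (HasSuffix (w ∷ʳ b) × L w ≤ L (w ∷ʳ b)) ⊎
                         (¬ HasSuffix (w ∷ʳ b) × L w < L (w ∷ʳ b))
    L-∷ʳ-cases [] b with em {(b ∷ []) ∈ X}
    ... | yes b∈ = inj₁ ((b ∷ [] , b∈ , here (Pointwise.refl refl)) , L-∷ b [])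
    ... | no b∉  = inj₂ (¬HasSuffix-∷ b∉ ¬HasSuffix-[] , ≤-reflexive (sym (L-noPrefix ¬pre)))
      where
      ¬pre : ¬ HasPrefix (b ∷ [])
      ¬pre (_ , p∈ , [])        = nonemptyWords p∈ refl
      ¬pre (_ , p∈ , refl ∷ []) = b∉ p∈
    L-∷ʳ-cases (c ∷ w) b with em {(c ∷ w ∷ʳ b) ∈ X} | L-∷ʳ-cases w b
    ... | yes cwb∈ | inj₁ (h , _)   = contradiction h (¬HasSuffix-tail cwb∈)
    ... | yes cwb∈ | inj₂ (_ , lt)  =
      inj₁ ( (c ∷ w ∷ʳ b , cwb∈ , here (Pointwise.refl refl))
           , ≤-trans (L-∷-≤suc c w) (≤-trans lt (L-∷ c (w ∷ʳ b))))
    ... | no cwb∉  | inj₁ ((s , s∈ , p) , le) = inj₁ ((s , s∈ , there p) , L-∷-mono 0 c w b cwb∉ le)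
    ... | no cwb∉  | inj₂ (¬h , lt) = inj₂ (¬HasSuffix-∷ cwb∉ ¬h , L-∷-mono 1 c w b cwb∉ lt)

    L-∷ʳ : ∀ w b → L w ≤ L (w ∷ʳ b)
    L-∷ʳ w b = [ proj₂ , <⇒≤ ∘ proj₂ ]′ (L-∷ʳ-cases w b)

    L-++ʳ : ∀ w s → L w ≤ L (w ++ s)
    L-++ʳ w []      = ≤-reflexive (cong L (sym (++-identityʳ w)))
    L-++ʳ w (b ∷ s) = begin
      L w                    ≤⟨ L-∷ʳ w b ⟩
      L (w ∷ʳ b)             ≤⟨ L-++ʳ (w ∷ʳ b) s ⟩
      L ((w ∷ʳ b) ++ s)      ≡⟨ cong L (++-assoc w (b ∷ []) s) ⟩
      L (w ++ b ∷ s)         ∎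
      where open ≤-Reasoning

    L-infix : ∀ {v w} → Infix _≡_ v w → L v ≤ L w
    L-infix {v} (here p) with s , refl ← prefix⇒++ p = L-++ʳ v s
    L-infix {w = c ∷ w} (there i) = ≤-trans (L-infix i) (L-∷ c w)

-- Uniform thresholds

module _ (em : ExcludedMiddle 0ℓ) {A : Set} {k : ℕ} (A↔Fin : A ↔ Fin k)
         {F : Language A} (rec : Recurrent F) where
  open Recurrent rec
  open Code em using (HasPrefix; L; L-++ˡ; L-hasPrefix; L-noPrefix; L-∷-≤⇒hasPrefix; L-++ʳ; L-infix; prefix⇒≡; parseCount; parseCount⇒≡L)

  alphabet : List A
  alphabet = map (Inverse.from A↔Fin) (allFin k)

  ∈-alphabet : ∀ a → a ∈ˡ alphabet
  ∈-alphabet a = subst (_∈ˡ alphabet) (Inverse.strictlyInverseʳ A↔Fin a)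
    (∈-map⁺ (Inverse.from A↔Fin) (∈-allFin (Inverse.to A↔Fin a)))

  -- Being only a lower bound on `L`, this passes from `suc d` to `d`, as the induction needs.
  Threshold : Language A → ℕ → ℕ → Set
  Threshold X d n = ∀ {w} → w ∈ F → n ≤ length w → d ≤ L X w

  -- No code occurs here, so a bound `m` depends only on `F`, `n` and `T`.
  Escapes : ℕ → List (Word A) → ℕ → Set
  Escapes n T m = ∀ {w} → w ∈ F → m ≤ length w →
    ¬ (∀ {v} → Infix _≡_ v w → length v ≡ n → v ∈ˡ T)

  few-parses : ∀ {X d n} → Threshold X d n → ∀ w → w ∈ F → suc n ≤ length w →
    (∀ {v} → Infix _≡_ v w → length v ≡ suc n → L X v ≤ d) → L X w ≤ d
  few-parses {X} {d} {n} thr (c ∷ w) cw∈ (s≤s n≤w) factors with m≤n⇒m<n∨m≡n n≤w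
  -- The word has length exactly `suc n` and is itself one of the factors.
  ... | inj₂ n≡w = factors Infix-refl (cong suc (sym n≡w))
  ... | inj₁ n<w = begin
    L X (c ∷ w)  ≡⟨ L-hasPrefix X (let p , p∈ , pre = cz-prefix in p , p∈ , cz-extends pre) ⟩
    L X w        ≤⟨ few-parses {X} thr w (factorClosed (there Infix-refl) cw∈) n<w (factors ∘ there) ⟩
    d            ∎
    where
    open ≤-Reasoning
    z = take n w
    z≡n : length z ≡ n
    z≡n = trans (length-take n w) (m≤n⇒m⊓n≡m n≤w)
    -- Here L(cz) ≤ d ≤ L(z), so prepending `c` adds no parse.
    cz-prefix : HasPrefix X (c ∷ z)
    cz-prefix = L-∷-≤⇒hasPrefix X (≤-trans
      (factors (here (refl ∷ prefix-take n w)) (cong suc z≡n))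
      (thr (factorClosed (there (here (prefix-take n w))) cw∈) (≤-reflexive (sym z≡n))))
    cz-extends : ∀ {p} → Prefix _≡_ p (c ∷ z) → Prefix _≡_ p (c ∷ w)
    cz-extends {p} pre =
      subst (λ y → Prefix _≡_ p (c ∷ y)) (take++drop≡id n w) (pre ++ᵖ drop n w)

  uniformThreshold : ∀ d → ∃[ n ] (∀ X → Bifix X → ∃ (Threshold X d) → Threshold X d n)
  uniformThreshold zero = 0 , λ _ _ _ _ _ → z≤n
  uniformThreshold (suc d)
    with n , thr ← uniformThreshold d
    -- `m` is fixed before `X`: it serves every set of words of length at most `suc n` that admits
    -- any bound.
    with m , escape ← commonBound em (Escapes (suc n))
                        (λ m≤m′ esc w∈ m′≤w → esc w∈ (≤-trans m≤m′ m′≤w))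
                        (sublists (wordsUpTo alphabet (suc n)))
    = m , threshold
    where
    threshold : ∀ X → Bifix X → ∃ (Threshold X (suc d)) → Threshold X (suc d) m
    -- If `w` had at most `d` parses, so would all its factors, which would then lie in the set
    -- attached to `X`, contrary to the choice of `m`.
    threshold X bifix (l , thrˡ) {w} w∈ m≤w = ≰⇒> λ Lw≤d →
      escape (filter∈sublists few? words) (l ⊔ suc n , escapes) w∈ m≤w
        λ {v} i v≡ → ∈-filter⁺ few? (∈-wordsUpTo ∈-alphabet v (≤-reflexive v≡))
                       (≤-trans (L-infix X bifix i) Lw≤d)
      where
      words = wordsUpTo alphabet (suc n)
      few? : Decidable (λ v → L X v ≤ d)
      few? v = L X v ≤? d
      thrⁿ : Threshold X d n
      thrⁿ = thr X bifix (l , λ w∈ l≤w → <⇒≤ (thrˡ w∈ l≤w))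
      -- The threshold `l` of `X` itself only shows that some bound exists; `suc n` is the length
      -- from which `few-parses` applies.
      escapes : Escapes (suc n) (filter few? words) (l ⊔ suc n)
      escapes {w} w∈ ≤w factors = <⇒≱ (thrˡ w∈ (≤-trans (m≤m⊔n l (suc n)) ≤w))
        (few-parses {X} thrⁿ w w∈ (≤-trans (m≤n⊔m l (suc n)) ≤w)
          λ i v≡ → proj₂ (∈-filter⁻ few? {xs = words} (factors i v≡)))

  -- Bifix codes of degree `d`

  module _ {X : Language A} {d : ℕ} (bifix : Bifix X) (degree : HasDegree F X d) where
    open HasDegree degree

    L≤d : ∀ {w} → w ∈ F → L X w ≤ d
    L≤d w∈ = upperBound w∈ (parseCount X bifix _)

    -- Otherwise a word of F starting with c ∷ w and ending with a word with d parses
    -- would have d + 1 parses.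
    long⇒hasPrefix : ∀ {c w} → (c ∷ w) ∈ F → (∀ {x} → x ∈ X → length x ≤ length (c ∷ w)) →
      HasPrefix X (c ∷ w)
    long⇒hasPrefix {c} {w} cw∈ long = decidable-stable em λ ¬h →
      let u , u∈ , count = attained
          t , _ , cwtu∈  = recurrent cw∈ u∈
          ¬h′ : ¬ HasPrefix X (c ∷ w ++ t ++ u)
          ¬h′ (p , p∈ , pre) = ¬h (p , p∈ , prefix-shorten (c ∷ w) (t ++ u) (long p∈) pre)
      in 1+n≰n (begin
        suc d                        ≡⟨ cong suc (parseCount⇒≡L X bifix count) ⟩
        suc (L X u)                  ≤⟨ s≤s (L-++ˡ X t u) ⟩
        suc (L X (t ++ u))           ≤⟨ s≤s (L-++ˡ X w (t ++ u)) ⟩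
        suc (L X (w ++ t ++ u))      ≡⟨ L-noPrefix X ¬h′ ⟨
        L X (c ∷ w ++ t ++ u)        ≤⟨ L≤d cwtu∈ ⟩
        d                            ∎)
      where open ≤-Reasoning

    -- Each prepended letter starts a word with a prefix in `X`, by `long⇒hasPrefix`, and so adds no
    -- parse.
    L-++ˡ-long : ∀ s {w} → (s ++ w) ∈ F → (∀ {x} → x ∈ X → length x ≤ length w) →
      L X (s ++ w) ≡ L X w
    L-++ˡ-long []      _   _    = refl
    L-++ˡ-long (c ∷ s) {w} sw∈ long = trans
      (L-hasPrefix X (long⇒hasPrefix sw∈ λ x∈ →
        ≤-trans (long x∈) (length-++-≤ʳ (c ∷ s) w)))
      (L-++ˡ-long s (factorClosed (there Infix-refl) sw∈) long)

    -- Recurrence places a word `u` with `d` parses to the left of `w`. The whole then has at least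
    -- `d` parses, and if `w` is as long as every code word, all of them are already counted by `w`.
    finite⇒threshold : IsFinite X → ∃ (Threshold X d)
    finite⇒threshold (ws , X⊆ws)
      with n , bound ← commonBound em (λ w n → length w ≤ n) (λ m≤n w≤m → ≤-trans w≤m m≤n) ws
      = n , λ {w} w∈ n≤w →
        let u , u∈ , count = attained
            t , _ , utw∈   = recurrent u∈ w∈
            long : ∀ {x} → x ∈ X → length x ≤ length w
            long {x} x∈ = ≤-trans (bound (X⊆ws x x∈) (length x , ≤-refl)) n≤w
        in begin
          d                     ≡⟨ parseCount⇒≡L X bifix count ⟩
          L X u                 ≤⟨ L-++ʳ X bifix u (t ++ w) ⟩
          L X (u ++ t ++ w)     ≡⟨ L-++ˡ-long u utw∈ (λ x∈ → ≤-trans (long x∈) (length-++-≤ʳ t w)) ⟩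
          L X (t ++ w)          ≡⟨ L-++ˡ-long t (factorClosed (u ++ⁱ Infix-refl) utw∈) long ⟩
          L X w                 ∎
      where open ≤-Reasoning

    -- A longer word of X would be c z b with |z| ≥ n and L(cz) ≤ d ≤ L(z), so that its
    -- proper prefix cz would itself have a prefix in X.
    threshold⇒short : ∀ {n} → Threshold X d n → ∀ {x} → x ∈ X → x ∈ F → length x ≤ suc n
    threshold⇒short {n} thr {[]}    _   _   = z≤n
    threshold⇒short {n} thr {c ∷ y} x∈  x∈F = s≤s (≮⇒≥ λ n<y →
      let z       = take n y
          z≡n     = trans (length-take n y) (m≤n⇒m⊓n≡m (<⇒≤ n<y))
          pre     = prefix-take n y
          p , p∈ , p≼cz = L-∷-≤⇒hasPrefix X {c} {z} (≤-trans
                      (L≤d (factorClosed (here (refl ∷ pre)) x∈F))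
                      (thr (factorClosed (there (here pre)) x∈F) (≤-reflexive (sym z≡n))))
          p≡x     = prefix⇒≡ X bifix p∈ x∈ (Prefixₚ.trans trans p≼cz (refl ∷ pre))
      in <⇒≱ n<y (s≤s⁻¹ (begin
           suc (length y) ≡⟨ cong length p≡x ⟨
           length p       ≤⟨ Prefixₚ.length-mono p≼cz ⟩
           suc (length z) ≡⟨ cong suc z≡n ⟩
           suc n          ∎)))
      where open ≤-Reasoning

mainTheorem9 : ExcludedMiddle 0ℓ →
    (A : Set) (k : ℕ) → A ↔ Fin k →
    (F : Language A) → Recurrent F →
    (d : ℕ) → 1 ≤ d →
    FinitelyMany (λ X → IsFinite X × MaximalBifix F X × HasDegree F X d)
mainTheorem9 em A k A↔Fin F rec d _ =
    map (λ ws w → w ∈ˡ ws) (sublists words) , λ X (finite , maximal , degree) →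
    let open MaximalBifix maximal
        X? : Decidable X
        X? _ = em
        -- The uniform threshold does not depend on `X`, so neither does this bound on the length of
        -- its words.
        short = threshold⇒short em A↔Fin rec bifix degree
                  (proj₂ threshold X bifix (finite⇒threshold em A↔Fin rec bifix degree finite))
    -- `X` is represented by the sublist of `words` that excluded middle selects.
    in lose (∈-map⁺ (λ ws w → w ∈ˡ ws) (filter∈sublists X? words))
         ( (λ {x} x∈ → ∈-filter⁺ X? (∈-wordsUpTo (∈-alphabet em A↔Fin rec) x (short x∈ (included x∈))) x∈)
         , (λ x∈ → proj₂ (∈-filter⁻ X? {xs = words} x∈)))
  where
  threshold = uniformThreshold em A↔Fin rec d
  words = wordsUpTo (alphabet em A↔Fin rec) (suc (proj₁ threshold))
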